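{- For any positive integers $q,n,k$ with $q\leq n$ and $k\leq 2^n$, $$m_q(n,k)=h_q(n,k).$$ That is, the minimum of $m_q(M)$ over all $k\times n$ binary matrices $M$ with pairwise distinct rows is attained by the matrix $H_{n,k}$ whose rows are the $n$-bit binary representations of $0,1,\dots,k-1$.
   Context: For integers $a\le b$, $[a,b]=\{a,a+1,\dots,b\}$. $\binom{[1,n]}{q}$ denotes the set of $q$-element subsets of $[1,n]$. $\mathcal{M}_{n,k}$ is the set of all $k\times n$ binary ($0/1$) matrices whose $k$ rows are pairwise distinct. For a binary matrix $A$, $\mathrm{dif}(A)$ is the number of distinct rows of $A$ (the cardinality of the set of its rows). For a set $Q$ of column indices, $M(Q)$ is the submatrix of $M$ formed by the columns with indices in $Q$. For $M\in\mathcal{M}_{n,k}$ put $$m_q(M)=\sum_{Q\in\binom{[1,n]}{q}}\mathrm{dif}(M(Q)),\qquad m_q(n,k)=\min_{M\in\mathcal{M}_{n,k}}m_q(M).$$ $H_{n,k}$ ($1\le k\le 2^n$) is the $k\times n$ binary matrix whose rows are the binary representations of the integers $0,1,\dots,k-1$, padded with leading zeros to length $n$ (the order of the rows is irrelevant for $m_q$). Finally $h_q(n,k)=m_q(H_{n,k})$. -}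

module Defs where

open import Data.Digit using (Bit; 0b; 1b)
import Data.Fin.Properties as Fin
open import Data.Fin.Base using (Fin; zero; suc; combine; finToFun; funToFin; inject≤)
open import Data.Fin.Subset using (Subset; inside; outside; ∣_∣)
open import Data.List.Base as List using (List; []; _∷_; [_]; filter; deduplicate; length; cartesianProductWith)
open import Data.List.Extrema.Nat using (argmin; argmin-sel; f[argmin]≤f[xs])
open import Data.List.Membership.Propositional using (_∈_)
open import Data.List.Membership.Propositional.Properties using (∈-filter⁺; ∈-filter⁻; ∈-cartesianProductWith⁺)
import Data.List.Relation.Unary.All as All
open import Data.List.Relation.Unary.Any using (here; there)
open import Data.Nat.Base using (ℕ; zero; suc; _≤_; _^_)
import Data.Nat.Properties as ℕ
open import Data.Nat.ListAction using (sum)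
open import Data.Product.Base using (∃; _×_; _,_; proj₁; proj₂)
open import Data.Sum.Base using (inj₁; inj₂)
open import Data.Vec.Base as Vec using (Vec; []; _∷_; tabulate; lookup)
import Data.Vec.Properties as Vec
import Data.Vec.Relation.Unary.AllPairs as AllPairs
open import Data.Vec.Relation.Unary.Unique.Propositional using (Unique)
open import Data.Vec.Relation.Unary.Unique.Propositional.Properties using (tabulate⁺)
open import Function.Base using (_∘_)
open import Relation.Binary.Definitions using (DecidableEquality)
open import Relation.Binary.PropositionalEquality using (_≡_; _≗_; refl; sym; trans; cong; cong₂; subst)
open import Relation.Nullary.Decidable using (Dec; ¬?)

private
  variable
    A : Set
    n k : ℕ

Row : ℕ → Set
Row n = Vec Bit n

-- A k × n matrix is the vector of its k rows.
Matrix : ℕ → ℕ → Set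
Matrix k n = Vec (Row n) k

-- Membership in 𝓜ₙ,ₖ.
DistinctRows : Matrix k n → Set
DistinctRows M = Unique M

_≟ᴿ_ : DecidableEquality (Row n)
_≟ᴿ_ = Vec.≡-dec Fin._≟_

dif : Matrix k n → ℕ
dif M = length (deduplicate _≟ᴿ_ (Vec.toList M))

select : (Q : Subset n) → Vec A n → Vec A ∣ Q ∣
select []            []       = []
select (inside  ∷ Q) (x ∷ xs) = x ∷ select Q xs
select (outside ∷ Q) (x ∷ xs) = select Q xs

-- The submatrix M(Q).
_⟨_⟩ : Matrix k n → (Q : Subset n) → Matrix k ∣ Q ∣
M ⟨ Q ⟩ = Vec.map (select Q) M

-- All vectors of length n with entries from a list; repetition-free if the
-- list is.
vectors : List A → (n : ℕ) → List (Vec A n)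
vectors xs zero    = [ [] ]
vectors xs (suc n) = cartesianProductWith _∷_ xs (vectors xs n)

subsetsOfSize : ℕ → (n : ℕ) → List (Subset n)
subsetsOfSize q n = filter (λ Q → ∣ Q ∣ ℕ.≟ q) (vectors (inside ∷ outside ∷ []) n)

mOf : ℕ → Matrix k n → ℕ
mOf {n = n} q M = sum (List.map (λ Q → dif (M ⟨ Q ⟩)) (subsetsOfSize q n))

-- finToFun lists base-2 digits with the most significant one first, so this is
-- the binary representation of i padded with leading zeros to length n.
binary : Fin (2 ^ n) → Row n
binary i = tabulate (finToFun i)

H : (n k : ℕ) → .(k ≤ 2 ^ n) → Matrix k n
H n k k≤2ⁿ = tabulate (λ i → binary (inject≤ i k≤2ⁿ))

h : (q n k : ℕ) → .(k ≤ 2 ^ n) → ℕ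
h q n k k≤2ⁿ = mOf q (H n k k≤2ⁿ)

-- v = min { f x ∣ P x }
IsMinimum : (A → Set) → (A → ℕ) → ℕ → Set
IsMinimum P f v = (∃ λ x → P x × f x ≡ v) × (∀ x → P x → v ≤ f x)

------------------------------------------------------------------------
-- Existence of the minimum over 𝓜ₙ,ₖ. H only serves to show that 𝓜ₙ,ₖ is
-- nonempty when k ≤ 2ⁿ; minimum-exists quantifies over every matrix in 𝓜ₙ,ₖ.

funToFin-cong : ∀ {m n} {f g : Fin m → Fin n} → f ≗ g → funToFin f ≡ funToFin g
funToFin-cong {zero}  f≗g = refl
funToFin-cong {suc m} f≗g =
  cong₂ combine (f≗g zero) (funToFin-cong (f≗g ∘ suc))

binary-injective : {i j : Fin (2 ^ n)} → binary i ≡ binary j → i ≡ j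
binary-injective {n} {i} {j} eq =
  trans (sym (Fin.funToFin-finToFin {n} i))
    (trans (funToFin-cong digits≗) (Fin.funToFin-finToFin {n} j))
  where
  digits≗ : finToFun {2} {n} i ≗ finToFun j
  digits≗ t = trans (sym (Vec.lookup∘tabulate (finToFun i) t))
    (trans (cong (λ r → lookup r t) eq) (Vec.lookup∘tabulate (finToFun j) t))

H-distinctRows : ∀ n k .(k≤2ⁿ : k ≤ 2 ^ n) → DistinctRows (H n k k≤2ⁿ)
H-distinctRows n k k≤2ⁿ =
  tabulate⁺ (λ eq → Fin.inject≤-injective k≤2ⁿ k≤2ⁿ _ _ (binary-injective {n} eq))

∈-vectors : {xs : List A} → (∀ x → x ∈ xs) → (v : Vec A n) → v ∈ vectors xs n
∈-vectors ∈xs []      = here refl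
∈-vectors ∈xs (x ∷ v) = ∈-cartesianProductWith⁺ _∷_ (∈xs x) (∈-vectors ∈xs v)

matrices : (k n : ℕ) → List (Matrix k n)
matrices k n = vectors (vectors (0b ∷ 1b ∷ []) n) k

∈-matrices : (M : Matrix k n) → M ∈ matrices k n
∈-matrices = ∈-vectors (∈-vectors λ { zero → here refl ; (suc zero) → there (here refl) })

distinctRows? : (M : Matrix k n) → Dec (DistinctRows M)
distinctRows? = AllPairs.allPairs? (λ r s → ¬? (r ≟ᴿ s))

minimum-exists : ∀ q n k → .(k ≤ 2 ^ n) →
                 ∃ (IsMinimum (DistinctRows {k} {n}) (mOf q))
minimum-exists q n k k≤2ⁿ =
  mOf q M₀ , (M₀ , M₀-distinctRows , refl) , M₀-least
  where
  H₀ = H n k k≤2ⁿ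
  Ms = filter distinctRows? (matrices k n)
  M₀ = argmin (mOf q) H₀ Ms

  M₀-distinctRows : DistinctRows M₀
  M₀-distinctRows with argmin-sel (mOf q) H₀ Ms
  ... | inj₁ M₀≡H = subst DistinctRows (sym M₀≡H) (H-distinctRows n k k≤2ⁿ)
  ... | inj₂ M₀∈  = proj₂ (∈-filter⁻ distinctRows? {xs = matrices k n} M₀∈)

  M₀-least : ∀ M → DistinctRows M → mOf q M₀ ≤ mOf q M
  M₀-least M distinct =
    All.lookup (f[argmin]≤f[xs] H₀ Ms) (∈-filter⁺ distinctRows? (∈-matrices M) distinct)

m : (q n k : ℕ) → .(k ≤ 2 ^ n) → ℕ
m q n k k≤2ⁿ = proj₁ (minimum-exists q n k k≤2ⁿ)

-- Write s i for the number of ones in binary i. Row i of H restricted to Q does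
-- not occur among the earlier rows exactly when Q contains the ones of row i, so
-- h is the sum over i < k of c (s i), where c t counts the q-subsets containing t
-- given columns; c is antitone. For any matrix, split the rows by their first
-- bit into a ≥ b rows. By induction it suffices that, for antitone g,
--   Σ_{i < a+b} g (s i) ≤ Σ_{i < a} g (s i) + Σ_{i < b} g (s i + 1),
-- which follows by halving a and b. Subsets Q are weighted by an arbitrary
-- function of ∣ Q ∣, because selecting the first column shifts q.

module Submission where

open import Defs
open import Data.Bool.Base using (true; false; if_then_else_)
open import Data.Digit using (Bit; 0b; 1b)
open import Data.Empty using (⊥)
import Data.Fin.Properties as Fin
open import Data.Fin.Base using (Fin; zero; suc; toℕ; combine; quotient; remainder; remQuot; inject≤)
open import Data.Fin.Subset using (Subset; inside; outside; ∣_∣)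
open import Data.List.Base using (List; []; _∷_; [_]; _++_; map; filter; deduplicate; length)
open import Data.List.Membership.Propositional using (_∈_)
open import Data.List.Membership.Propositional.Properties
  using (∈-∃++; ∈-map⁺; ∈-map⁻; ∈-++⁺ˡ; ∈-++⁺ʳ; ∈-++⁻; ∈-deduplicate⁺; ∈-deduplicate⁻)
open import Data.List.Properties using (map-++; map-∘; map-cong; length-map; length-++; ++-identityʳ)
open import Data.List.Relation.Binary.Permutation.Propositional.Properties using (shift; ↭-length)
open import Data.List.Relation.Binary.Subset.Propositional using (_⊆_)
open import Data.List.Relation.Binary.Subset.Propositional.Properties
  using (⊆-respʳ-↭; ⊆∷∧∉⇒⊆) renaming (map⁺ to ⊆-map⁺)
open import Data.List.Relation.Unary.All using (_∷_)
open import Data.List.Relation.Unary.All.Properties using (¬Any⇒All¬)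
open import Data.List.Relation.Unary.AllPairs using ([]; _∷_)
open import Data.List.Relation.Unary.Any using (here; there)
open import Data.List.Relation.Unary.Unique.DecPropositional.Properties using (deduplicate-!)
open import Data.List.Relation.Unary.Unique.Propositional using (Unique)
open import Data.List.Relation.Unary.Unique.Propositional.Properties
  using (Unique[x∷xs]⇒x∉xs) renaming (map⁺ to unique-map⁺; ++⁺ to unique-++⁺)
open import Data.Nat.Base
open import Data.Nat.ListAction using (sum)
open import Data.Nat.ListAction.Properties using (sum-++)
open import Data.Nat.Properties
open import Data.Nat.Tactic.RingSolver using (solve-∀)
open import Data.Product.Base using (_×_; _,_; proj₂; uncurry)
open import Data.Sum.Base using (_⊎_; inj₁; inj₂)
open import Data.Vec.Base as Vec using ([]; _∷_; toList)
import Data.Vec.Properties as Vec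
import Data.Vec.Relation.Unary.All.Properties as VecAll
import Data.Vec.Relation.Unary.Any.Properties as VecAny
import Data.Vec.Relation.Unary.AllPairs as VecAllPairs
open import Function.Base using (_∘_)
open import Relation.Binary.PropositionalEquality using (_≡_; refl; sym; trans; cong; cong₂; subst; subst₂; module ≡-Reasoning)
open import Relation.Nullary.Decidable using (yes; no; does)
open import Relation.Nullary.Negation using (contradiction)

private
  variable
    A : Set
    n k : ℕ

-- Sums over an initial segment of the integers of a function of the number of ones.

interchange : ∀ a b c d → (a + b) + (c + d) ≡ (a + c) + (b + d)
interchange = solve-∀

Antitone : (ℕ → ℕ) → Set
Antitone g = ∀ s → g (suc s) ≤ g s

-- For k ≤ 2ⁿ this is the sum of g (s i) over i < k, where s i is the number of
-- ones in binary i: an even number 2i has s i ones and 2i + 1 has one more.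
popSum : (ℕ → ℕ) → ℕ → ℕ → ℕ
popSum g zero    zero    = 0
popSum g zero    (suc _) = g 0
popSum g (suc n) k       = popSum g n ⌈ k /2⌉ + popSum (g ∘ suc) n ⌊ k /2⌋

popSum-empty : ∀ g n → popSum g n 0 ≡ 0
popSum-empty g zero    = refl
popSum-empty g (suc n) = cong₂ _+_ (popSum-empty g n) (popSum-empty (g ∘ suc) n)

-- Integers of `n` bits have at most `n` ones, so only arguments `s ≤ n` enter. This range is what
-- makes `coverage-pascal` applicable.
popSum-+ : ∀ {f g h : ℕ → ℕ} n → (∀ {s} → s ≤ n → f s ≡ g s + h s) →
           ∀ k → popSum f n k ≡ popSum g n k + popSum h n k
popSum-+ zero    f≡g+h zero    = refl
popSum-+ zero    f≡g+h (suc k) = f≡g+h z≤n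
popSum-+ {f} {g} {h} (suc n) f≡g+h k = trans
  (cong₂ _+_ (popSum-+ n (f≡g+h ∘ m≤n⇒m≤1+n) ⌈ k /2⌉) (popSum-+ n (f≡g+h ∘ s≤s) ⌊ k /2⌋))
  (interchange (popSum g n ⌈ k /2⌉) _ _ _)

popSum-even : ∀ g n z → popSum g (suc n) (z + z) ≡ popSum g n z + popSum (g ∘ suc) n z
popSum-even g n z = cong₂ (λ x y → popSum g n x + popSum (g ∘ suc) n y)
  (sym (n≡⌈n+n/2⌉ z)) (sym (n≡⌊n+n/2⌋ z))

popSum-odd : ∀ g n z → popSum g (suc n) (suc (z + z)) ≡ popSum g n (suc z) + popSum (g ∘ suc) n z
popSum-odd g n z = cong₂ (λ x y → popSum g n (suc x) + popSum (g ∘ suc) n y)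
  (sym (n≡⌊n+n/2⌋ z)) (sym (n≡⌈n+n/2⌉ z))

popSum-even′ : ∀ g n z → popSum g (suc n) (suc (suc (z + z))) ≡ popSum g n (suc z) + popSum (g ∘ suc) n (suc z)
popSum-even′ g n z = trans (cong (popSum g (suc n) ∘ suc) (sym (+-suc z z))) (popSum-even g n (suc z))

data Halved : ℕ → Set where
  even : ∀ z → Halved (z + z)
  odd  : ∀ z → Halved (suc (z + z))

halve : ∀ k → Halved k
halve zero = even 0
halve (suc k) with halve k
... | even z = odd z
... | odd z  = subst Halved (cong suc (+-suc z z)) (even (suc z))

-- For `y < 2 ^ n`, passing from `y` to `suc y` adds the single term at the number of ones of `y`;
-- for larger `y` both sums are saturated. So the increment for `h` is at most that for `g`, written
-- additively to avoid subtraction. After halving, only one half grows: the even integers if `y` is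
-- even, the odd ones otherwise.
popSum-exchange : ∀ {g h : ℕ → ℕ} n y → (∀ s → h s ≤ g s) →
  popSum g n y + popSum h n (suc y) ≤ popSum g n (suc y) + popSum h n y
popSum-exchange {g} {h} zero zero    h≤g = ≤-trans (h≤g 0) (m≤m+n (g 0) 0)
popSum-exchange zero (suc y) h≤g = ≤-refl
popSum-exchange {g} {h} (suc n) y h≤g with halve y
... | even z = begin
  popSum g (suc n) (z + z) + popSum h (suc n) (suc (z + z))
    ≡⟨ cong₂ _+_ (popSum-even g n z) (popSum-odd h n z) ⟩
  (popSum g n z + popSum g′ n z) + (popSum h n (suc z) + popSum h′ n z)
    ≡⟨ interchange (popSum g n z) _ _ _ ⟩
  (popSum g n z + popSum h n (suc z)) + (popSum g′ n z + popSum h′ n z)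
    ≤⟨ +-monoˡ-≤ _ (popSum-exchange n z h≤g) ⟩
  (popSum g n (suc z) + popSum h n z) + (popSum g′ n z + popSum h′ n z)
    ≡⟨ interchange (popSum g n (suc z)) _ _ _ ⟩
  (popSum g n (suc z) + popSum g′ n z) + (popSum h n z + popSum h′ n z)
    ≡⟨ cong₂ _+_ (popSum-odd g n z) (popSum-even h n z) ⟨
  popSum g (suc n) (suc (z + z)) + popSum h (suc n) (z + z) ∎
  where
  open ≤-Reasoning
  g′ = g ∘ suc
  h′ = h ∘ suc
... | odd z = begin
  popSum g (suc n) (suc (z + z)) + popSum h (suc n) (suc (suc (z + z)))
    ≡⟨ cong₂ _+_ (popSum-odd g n z) (popSum-even′ h n z) ⟩
  (popSum g n (suc z) + popSum g′ n z) + (popSum h n (suc z) + popSum h′ n (suc z))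
    ≡⟨ interchange (popSum g n (suc z)) _ _ _ ⟩
  (popSum g n (suc z) + popSum h n (suc z)) + (popSum g′ n z + popSum h′ n (suc z))
    ≤⟨ +-monoʳ-≤ (popSum g n (suc z) + popSum h n (suc z)) (popSum-exchange n z (h≤g ∘ suc)) ⟩
  (popSum g n (suc z) + popSum h n (suc z)) + (popSum g′ n (suc z) + popSum h′ n z)
    ≡⟨ interchange (popSum g n (suc z)) _ _ _ ⟩
  (popSum g n (suc z) + popSum g′ n (suc z)) + (popSum h n (suc z) + popSum h′ n z)
    ≡⟨ cong₂ _+_ (popSum-even′ g n z) (popSum-odd h n z) ⟨
  popSum g (suc n) (suc (suc (z + z))) + popSum h (suc n) (suc (z + z)) ∎
  where
  open ≤-Reasoning
  g′ = g ∘ suc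
  h′ = h ∘ suc

cancel-double-≤ : ∀ {x y} → y + y ≤ x + x → y ≤ x
cancel-double-≤ {x} {y} p = subst₂ _≤_ (sym (n≡⌊n+n/2⌋ y)) (sym (n≡⌊n+n/2⌋ x)) (⌊n/2⌋-mono p)

cancel-double-odd-≤ : ∀ {x y} → y + y ≤ suc (x + x) → y ≤ x
cancel-double-odd-≤ {x} {y} p = subst₂ _≤_ (sym (n≡⌊n+n/2⌋ y)) (sym (n≡⌈n+n/2⌉ x)) (⌊n/2⌋-mono p)

cancel-double-odd-< : ∀ {x y} → suc (y + y) ≤ x + x → y < x
cancel-double-odd-< {x} {y} p = subst₂ _≤_ (cong suc (sym (n≡⌊n+n/2⌋ y))) (sym (n≡⌈n+n/2⌉ x)) (⌊n/2⌋-mono (s≤s p))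

-- Splitting the integers below `a + b` by parity gives a sum for `g` and one for `g ∘ suc`;
-- induction splits each into a half of `a` and a half of `b`. The larger part must go with `g`: for
-- `a = 0`, `b = 1` the inequality would read `g 0 ≤ g 1`. The roundings can fail to match only when
-- `a` and `b` are both odd.
popSum-subadditive : ∀ {g} → Antitone g → ∀ n {a b} → b ≤ a →
  popSum g n (a + b) ≤ popSum g n a + popSum (g ∘ suc) n b
popSum-subadditive g↓ zero {zero} {zero} b≤a = z≤n
popSum-subadditive g↓ zero {suc a} b≤a = m≤m+n _ _
popSum-subadditive {g} g↓ (suc n) {a} {b} b≤a with halve a | halve b
... | even x | even y = begin
  popSum g (suc n) (x + x + (y + y))
    ≡⟨ cong (popSum g (suc n)) (interchange x x y y) ⟩
  popSum g (suc n) (x + y + (x + y))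
    ≡⟨ popSum-even g n (x + y) ⟩
  popSum g n (x + y) + popSum g′ n (x + y)
    ≤⟨ +-mono-≤ (popSum-subadditive g↓ n y≤x) (popSum-subadditive (g↓ ∘ suc) n y≤x) ⟩
  (popSum g n x + popSum g′ n y) + (popSum g′ n x + popSum g″ n y)
    ≡⟨ interchange (popSum g n x) _ _ _ ⟩
  (popSum g n x + popSum g′ n x) + (popSum g′ n y + popSum g″ n y)
    ≡⟨ cong₂ _+_ (popSum-even g n x) (popSum-even g′ n y) ⟨
  popSum g (suc n) (x + x) + popSum g′ (suc n) (y + y) ∎
  where
  open ≤-Reasoning
  g′ = g ∘ suc
  g″ = g′ ∘ suc
  y≤x = cancel-double-≤ b≤a
... | odd x | even y = begin
  popSum g (suc n) (suc (x + x + (y + y)))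
    ≡⟨ cong (popSum g (suc n) ∘ suc) (interchange x x y y) ⟩
  popSum g (suc n) (suc (x + y + (x + y)))
    ≡⟨ popSum-odd g n (x + y) ⟩
  popSum g n (suc x + y) + popSum g′ n (x + y)
    ≤⟨ +-mono-≤ (popSum-subadditive g↓ n (m≤n⇒m≤1+n y≤x)) (popSum-subadditive (g↓ ∘ suc) n y≤x) ⟩
  (popSum g n (suc x) + popSum g′ n y) + (popSum g′ n x + popSum g″ n y)
    ≡⟨ interchange (popSum g n (suc x)) _ _ _ ⟩
  (popSum g n (suc x) + popSum g′ n x) + (popSum g′ n y + popSum g″ n y)
    ≡⟨ cong₂ _+_ (popSum-odd g n x) (popSum-even g′ n y) ⟨
  popSum g (suc n) (suc (x + x)) + popSum g′ (suc n) (y + y) ∎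
  where
  open ≤-Reasoning
  g′ = g ∘ suc
  g″ = g′ ∘ suc
  y≤x = cancel-double-odd-≤ b≤a
... | even x | odd y = begin
  popSum g (suc n) (x + x + suc (y + y))
    ≡⟨ cong (popSum g (suc n)) (trans (+-suc (x + x) (y + y)) (cong suc (interchange x x y y))) ⟩
  popSum g (suc n) (suc (x + y + (x + y)))
    ≡⟨ popSum-odd g n (x + y) ⟩
  popSum g n (suc (x + y)) + popSum g′ n (x + y)
    ≡⟨ cong (λ z → popSum g n z + popSum g′ n (x + y)) (+-suc x y) ⟨
  popSum g n (x + suc y) + popSum g′ n (x + y)
    -- An odd `b` below an even `a` forces `y < x`, so `suc y` may serve as the smaller part.
    ≤⟨ +-mono-≤ (popSum-subadditive g↓ n y<x) (popSum-subadditive (g↓ ∘ suc) n (<⇒≤ y<x)) ⟩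
  (popSum g n x + popSum g′ n (suc y)) + (popSum g′ n x + popSum g″ n y)
    ≡⟨ interchange (popSum g n x) _ _ _ ⟩
  (popSum g n x + popSum g′ n x) + (popSum g′ n (suc y) + popSum g″ n y)
    ≡⟨ cong₂ _+_ (popSum-even g n x) (popSum-odd g′ n y) ⟨
  popSum g (suc n) (x + x) + popSum g′ (suc n) (suc (y + y)) ∎
  where
  open ≤-Reasoning
  g′ = g ∘ suc
  g″ = g′ ∘ suc
  y<x = cancel-double-odd-< b≤a
... | odd x | odd y = begin
  popSum g (suc n) (suc (x + x) + suc (y + y))
    ≡⟨ cong (popSum g (suc n) ∘ suc) (trans (+-suc (x + x) (y + y)) (cong suc (interchange x x y y))) ⟩
  popSum g (suc n) (suc (suc (x + y + (x + y))))
    ≡⟨ popSum-even′ g n (x + y) ⟩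
  popSum g n (suc x + y) + popSum g′ n (suc (x + y))
    ≤⟨ step (m≤n⇒m<n∨m≡n y≤x) ⟩
  (popSum g n (suc x) + popSum g′ n x) + (popSum g′ n (suc y) + popSum g″ n y)
    ≡⟨ cong₂ _+_ (popSum-odd g n x) (popSum-odd g′ n y) ⟨
  popSum g (suc n) (suc (x + x)) + popSum g′ (suc n) (suc (y + y)) ∎
  where
  open ≤-Reasoning
  g′ = g ∘ suc
  g″ = g′ ∘ suc
  y≤x = cancel-double-≤ (s≤s⁻¹ b≤a)
  step : y < x ⊎ y ≡ x → popSum g n (suc x + y) + popSum g′ n (suc (x + y)) ≤
         (popSum g n (suc x) + popSum g′ n x) + (popSum g′ n (suc y) + popSum g″ n y)
  -- Both halves have size `suc (x + y)`. Splitting them as `suc x + y` and `x + suc y` leaves one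
  -- unit under `g″` that the target has under `g′`; `popSum-exchange` moves it.
  step (inj₁ y<x) = begin
    popSum g n (suc x + y) + popSum g′ n (suc (x + y))
      ≡⟨ cong (λ z → popSum g n (suc x + y) + popSum g′ n z) (+-suc x y) ⟨
    popSum g n (suc x + y) + popSum g′ n (x + suc y)
      ≤⟨ +-mono-≤ (popSum-subadditive g↓ n (m≤n⇒m≤1+n y≤x)) (popSum-subadditive (g↓ ∘ suc) n y<x) ⟩
    (popSum g n (suc x) + popSum g′ n y) + (popSum g′ n x + popSum g″ n (suc y))
      ≡⟨ interchange (popSum g n (suc x)) _ _ _ ⟩
    (popSum g n (suc x) + popSum g′ n x) + (popSum g′ n y + popSum g″ n (suc y))
      ≤⟨ +-monoʳ-≤ (popSum g n (suc x) + popSum g′ n x) (popSum-exchange n y (g↓ ∘ suc)) ⟩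
    (popSum g n (suc x) + popSum g′ n x) + (popSum g′ n (suc y) + popSum g″ n y) ∎
  -- Here `x + suc y` would put the larger part second. Splitting both halves as `suc x + x` yields
  -- exactly the target terms.
  step (inj₂ refl) = begin
    popSum g n (suc x + x) + popSum g′ n (suc x + x)
      ≤⟨ +-mono-≤ (popSum-subadditive g↓ n (n≤1+n x)) (popSum-subadditive (g↓ ∘ suc) n (n≤1+n x)) ⟩
    (popSum g n (suc x) + popSum g′ n x) + (popSum g′ n (suc x) + popSum g″ n x) ∎

-- An extra leading zero leaves the number of ones unchanged; the bound says that `n` bits suffice.
popSum-stable : ∀ g n {k} → k ≤ 2 ^ n → popSum g (suc n) k ≡ popSum g n k
popSum-stable g zero    {zero}        k≤ = refl
popSum-stable g zero    {suc zero}    k≤ = +-identityʳ (g 0)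
popSum-stable g zero    {suc (suc _)} (s≤s ())
popSum-stable g (suc n) {k} k≤ = cong₂ _+_
  (popSum-stable g n half≤) (popSum-stable (g ∘ suc) n (≤-trans (⌊n/2⌋≤⌈n/2⌉ k) half≤))
  where
  half≤ : ⌈ k /2⌉ ≤ 2 ^ n
  half≤ = subst (⌈ k /2⌉ ≤_) (trans (cong (λ z → ⌈ 2 ^ n + z /2⌉) (+-identityʳ (2 ^ n))) (sym (n≡⌈n+n/2⌉ (2 ^ n)))) (⌈n/2⌉-mono k≤)

-- For `i < 2 ^ n`, the integer `2 ^ n + i` has one more one than `i`, in the leading place; for `r`
-- beyond `2 ^ n` both sides are constant in `r`. Since `popSum` strips the last bit, the induction
-- halves `2 ^ n` and `r` together.
popSum-2^n+ : ∀ g n r → popSum g (suc n) (2 ^ n + r) ≡ popSum g n (2 ^ n) + popSum (g ∘ suc) n r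
popSum-2^n+ g zero zero          = refl
popSum-2^n+ g zero (suc zero)    = refl
popSum-2^n+ g zero (suc (suc r)) = refl
popSum-2^n+ g (suc n) r = begin
  popSum g (suc n) ⌈ 2 ^ suc n + r /2⌉ + popSum g′ (suc n) ⌊ 2 ^ suc n + r /2⌋
    ≡⟨ cong₂ (λ x y → popSum g (suc n) x + popSum g′ (suc n) y) ⌈half⌉ (⌊half⌋ r) ⟩
  popSum g (suc n) (2 ^ n + ⌈ r /2⌉) + popSum g′ (suc n) (2 ^ n + ⌊ r /2⌋)
    ≡⟨ cong₂ _+_ (popSum-2^n+ g n ⌈ r /2⌉) (popSum-2^n+ g′ n ⌊ r /2⌋) ⟩
  (popSum g n (2 ^ n) + popSum g′ n ⌈ r /2⌉) + (popSum g′ n (2 ^ n) + popSum g″ n ⌊ r /2⌋)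
    ≡⟨ interchange (popSum g n (2 ^ n)) _ _ _ ⟩
  (popSum g n (2 ^ n) + popSum g′ n (2 ^ n)) + popSum g′ (suc n) r
    ≡⟨ cong (_+ popSum g′ (suc n) r) (popSum-even g n (2 ^ n)) ⟨
  popSum g (suc n) (2 ^ n + 2 ^ n) + popSum g′ (suc n) r
    ≡⟨ cong (λ z → popSum g (suc n) (2 ^ n + z) + popSum g′ (suc n) r) (+-identityʳ (2 ^ n)) ⟨
  popSum g (suc n) (2 ^ suc n) + popSum g′ (suc n) r ∎
  where
  open ≡-Reasoning
  g′ = g ∘ suc
  g″ = g′ ∘ suc
  ⌊a+a+r/2⌋ : ∀ a r → ⌊ (a + (a + 0)) + r /2⌋ ≡ a + ⌊ r /2⌋
  ⌊a+a+r/2⌋ zero    r = refl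
  ⌊a+a+r/2⌋ (suc a) r = trans (cong (λ z → ⌊ suc (z + r) /2⌋) (+-suc a (a + 0))) (cong suc (⌊a+a+r/2⌋ a r))
  ⌊half⌋ : ∀ r → ⌊ 2 ^ suc n + r /2⌋ ≡ 2 ^ n + ⌊ r /2⌋
  ⌊half⌋ = ⌊a+a+r/2⌋ (2 ^ n)
  ⌈half⌉ : ⌈ 2 ^ suc n + r /2⌉ ≡ 2 ^ n + ⌈ r /2⌉
  -- `⌈ k /2⌉` unfolds to `⌊ suc k /2⌋`, so this is the floor identity at `suc r`.
  ⌈half⌉ = trans (cong ⌊_/2⌋ (sym (+-suc (2 ^ suc n) r))) (⌊half⌋ (suc r))

-- Weights of subsets containing prescribed elements.

-- The sum of w ∣ Q ∣ over the subsets Q of an n-element set that contain s given elements.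
coverage : (ℕ → ℕ) → ℕ → ℕ → ℕ
coverage w zero    zero    = w 0
coverage w zero    (suc s) = 0
coverage w (suc n) zero    = coverage (w ∘ suc) n 0 + coverage w n 0
coverage w (suc n) (suc s) = coverage (w ∘ suc) n s

-- Prescribing one more element only loses subsets; at `s = 0` the loss is the summand of those
-- avoiding the first element.
coverage-antitone : ∀ w n → Antitone (coverage w n)
coverage-antitone w zero    s       = z≤n
coverage-antitone w (suc n) zero    = m≤m+n _ _
coverage-antitone w (suc n) (suc s) = coverage-antitone (w ∘ suc) n s

-- When `s ≤ n`, some element is not prescribed; the subsets split by whether they contain it.
coverage-pascal : ∀ w n {s} → s ≤ n → coverage w (suc n) s ≡ coverage (w ∘ suc) n s + coverage w n s
coverage-pascal w n       z≤n       = refl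
coverage-pascal w (suc n) (s≤s s≤n) = coverage-pascal (w ∘ suc) n s≤n

-- Counting distinct rows, and splitting them by the first bit.

-- Pigeonhole: the head of `xs` is moved to the front of `ys` and removed; as it does not recur in
-- `xs`, the inclusion of the tails survives.
unique-⊆⇒length≤ : {xs ys : List A} → Unique xs → xs ⊆ ys → length xs ≤ length ys
unique-⊆⇒length≤ {xs = []}     xs! xs⊆ys = z≤n
unique-⊆⇒length≤ {xs = x ∷ xs} xs!@(_ ∷ tail!) xs⊆ys with ∈-∃++ (xs⊆ys (here refl))
... | as , bs , refl = subst (suc (length xs) ≤_) (sym (↭-length (shift x as bs)))
  (s≤s (unique-⊆⇒length≤ tail!
    (⊆∷∧∉⇒⊆ (⊆-respʳ-↭ (shift x as bs) (xs⊆ys ∘ there)) (Unique[x∷xs]⇒x∉xs xs!))))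

countDistinct : List (Row n) → ℕ
countDistinct L = length (deduplicate _≟ᴿ_ L)

countDistinct-mono : {L L′ : List (Row n)} → L ⊆ L′ → countDistinct L ≤ countDistinct L′
countDistinct-mono {L = L} L⊆L′ = unique-⊆⇒length≤ (deduplicate-! _≟ᴿ_ L)
  (∈-deduplicate⁺ _≟ᴿ_ ∘ L⊆L′ ∘ ∈-deduplicate⁻ _≟ᴿ_ L)

slice : Bit → List (Row (suc n)) → List (Row n)
slice b []            = []
slice b ((c ∷ r) ∷ L) with b Fin.≟ c
... | yes _ = r ∷ slice b L
... | no  _ = slice b L

∈-slice⁺ : ∀ {b} {r : Row n} {L} → b ∷ r ∈ L → r ∈ slice b L
∈-slice⁺ {b = b} {L = (c ∷ r′) ∷ L} b∷r∈ with b Fin.≟ c | b∷r∈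
... | yes _  | here refl = here refl
... | yes _  | there p   = there (∈-slice⁺ p)
... | no b≢c | here refl = contradiction refl b≢c
... | no _   | there p   = ∈-slice⁺ p

∈-slice⁻ : ∀ {b} {r : Row n} L → r ∈ slice b L → b ∷ r ∈ L
∈-slice⁻ {b = b} ((c ∷ r′) ∷ L) r∈ with b Fin.≟ c | r∈
... | yes refl | here refl = here refl
... | yes _    | there p   = there (∈-slice⁻ L p)
... | no _     | p         = there (∈-slice⁻ L p)

slice-unique : ∀ b {L : List (Row (suc n))} → Unique L → Unique (slice b L)
slice-unique b {[]}          []            = []
slice-unique b {(c ∷ r) ∷ L} L!@(_ ∷ rest!) with b Fin.≟ c
... | yes refl = ¬Any⇒All¬ _ (Unique[x∷xs]⇒x∉xs L! ∘ ∈-slice⁻ L) ∷ slice-unique b rest!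
... | no _     = slice-unique b rest!

slice-length : (L : List (Row (suc n))) → length L ≡ length (slice 0b L) + length (slice 1b L)
slice-length []                   = refl
slice-length ((zero ∷ r) ∷ L)     = cong suc (slice-length L)
slice-length ((suc zero ∷ r) ∷ L) = trans (cong suc (slice-length L)) (sym (+-suc _ _))

slice⊆tails : ∀ b (L : List (Row (suc n))) → slice b L ⊆ map Vec.tail L
slice⊆tails b L r∈ = ∈-map⁺ Vec.tail (∈-slice⁻ L r∈)

-- Deduplicating each slice and prefixing its bit again gives a repetition-free list with the same
-- elements as `L`; mutual inclusion then equates the lengths.
countDistinct-slice : (L : List (Row (suc n))) →
  countDistinct L ≡ countDistinct (slice 0b L) + countDistinct (slice 1b L)
countDistinct-slice L = trans
  (≤-antisym (unique-⊆⇒length≤ (deduplicate-! _≟ᴿ_ L) (⊆U ∘ ∈-deduplicate⁻ _≟ᴿ_ L))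
             (unique-⊆⇒length≤ U! (∈-deduplicate⁺ _≟ᴿ_ ∘ U⊆)))
  (trans (length-++ (prefixed 0b)) (cong₂ _+_ (length-map _ (distinct 0b)) (length-map _ (distinct 1b))))
  where
  distinct : Bit → List (Row _)
  distinct b = deduplicate _≟ᴿ_ (slice b L)
  prefixed : Bit → List (Row _)
  prefixed b = map (b ∷_) (distinct b)

  U! : Unique (prefixed 0b ++ prefixed 1b)
  U! = unique-++⁺ (prefixed! 0b) (prefixed! 1b) disjoint
    where
    prefixed! : ∀ b → Unique (prefixed b)
    prefixed! b = unique-map⁺ Vec.∷-injectiveʳ (deduplicate-! _≟ᴿ_ (slice b L))
    disjoint : ∀ {r} → r ∈ prefixed 0b × r ∈ prefixed 1b → ⊥
    disjoint (p , p′) with ∈-map⁻ _ p | ∈-map⁻ _ p′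
    ... | _ , _ , refl | _ , _ , ()

  ∈-prefixed : ∀ b {r} → b ∷ r ∈ L → b ∷ r ∈ prefixed b
  ∈-prefixed b p = ∈-map⁺ (b ∷_) (∈-deduplicate⁺ _≟ᴿ_ (∈-slice⁺ p))

  ⊆U : ∀ {r} → r ∈ L → r ∈ prefixed 0b ++ prefixed 1b
  ⊆U {zero ∷ r}     p = ∈-++⁺ˡ (∈-prefixed 0b p)
  ⊆U {suc zero ∷ r} p = ∈-++⁺ʳ (prefixed 0b) (∈-prefixed 1b p)

  prefixed⊆ : ∀ b {r} → r ∈ prefixed b → r ∈ L
  prefixed⊆ b p with ∈-map⁻ (b ∷_) p
  ... | _ , q , refl = ∈-slice⁻ L (∈-deduplicate⁻ _≟ᴿ_ (slice b L) q)

  U⊆ : ∀ {r} → r ∈ prefixed 0b ++ prefixed 1b → r ∈ L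
  U⊆ p with ∈-++⁻ (prefixed 0b) p
  ... | inj₁ q = prefixed⊆ 0b q
  ... | inj₂ q = prefixed⊆ 1b q

-- Weighted sums over sets of columns.

subsets : ∀ n → List (Subset n)
subsets = vectors (inside ∷ outside ∷ [])

weightedDif : (ℕ → ℕ) → List (Row n) → ℕ
weightedDif {n} w L = sum (map (λ Q → w ∣ Q ∣ * countDistinct (map (select Q) L)) (subsets n))

sum-map-mono : ∀ {f g : A → ℕ} → (∀ x → f x ≤ g x) → ∀ xs → sum (map f xs) ≤ sum (map g xs)
sum-map-mono f≤g []       = z≤n
sum-map-mono f≤g (x ∷ xs) = +-mono-≤ (f≤g x) (sum-map-mono f≤g xs)

sum-map-+ : ∀ (f g : A → ℕ) xs → sum (map (λ x → f x + g x) xs) ≡ sum (map f xs) + sum (map g xs)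
sum-map-+ f g []       = refl
sum-map-+ f g (x ∷ xs) = trans (cong (f x + g x +_) (sum-map-+ f g xs)) (interchange (f x) _ _ _)

weightedDif-mono : ∀ w {L L′ : List (Row n)} → L ⊆ L′ → weightedDif w L ≤ weightedDif w L′
weightedDif-mono w L⊆L′ = sum-map-mono
  (λ Q → *-monoʳ-≤ (w ∣ Q ∣) (countDistinct-mono (⊆-map⁺ (select Q) L⊆L′))) (subsets _)

slice-select : ∀ b (Q : Subset n) L → slice b (map (select (inside ∷ Q)) L) ≡ map (select Q) (slice b L)
slice-select b Q []            = refl
slice-select b Q ((c ∷ r) ∷ L) with b Fin.≟ c
... | yes _ = cong (select Q r ∷_) (slice-select b Q L)
... | no _  = slice-select b Q L

-- Column sets containing the first column keep the two slices apart and shift the weight; the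
-- others see only the tails of the rows.
weightedDif-slice : ∀ w (L : List (Row (suc n))) →
  weightedDif w L ≡ weightedDif (w ∘ suc) (slice 0b L) + weightedDif (w ∘ suc) (slice 1b L)
                    + weightedDif w (map Vec.tail L)
weightedDif-slice {n} w L = begin
  sum (map F (map (inside ∷_) (subsets n) ++ map (outside ∷_) (subsets n) ++ []))
    ≡⟨ cong (λ z → sum (map F (map (inside ∷_) (subsets n) ++ z))) (++-identityʳ _) ⟩
  sum (map F (map (inside ∷_) (subsets n) ++ map (outside ∷_) (subsets n)))
    ≡⟨ cong sum (map-++ F (map (inside ∷_) (subsets n)) _) ⟩
  sum (map F (map (inside ∷_) (subsets n)) ++ map F (map (outside ∷_) (subsets n)))
    ≡⟨ sum-++ (map F (map (inside ∷_) (subsets n))) _ ⟩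
  sum (map F (map (inside ∷_) (subsets n))) + sum (map F (map (outside ∷_) (subsets n)))
    ≡⟨ cong₂ (λ x y → sum x + sum y) (map-∘ (subsets n)) (map-∘ (subsets n)) ⟨
  sum (map (F ∘ (inside ∷_)) (subsets n)) + sum (map (F ∘ (outside ∷_)) (subsets n))
    ≡⟨ cong₂ (λ x y → sum x + sum y) (map-cong F-inside (subsets n)) (map-cong F-outside (subsets n)) ⟩
  sum (map (λ Q → G 0b Q + G 1b Q) (subsets n)) + weightedDif w (map Vec.tail L)
    ≡⟨ cong (_+ weightedDif w (map Vec.tail L)) (sum-map-+ (G 0b) (G 1b) (subsets n)) ⟩
  weightedDif (w ∘ suc) (slice 0b L) + weightedDif (w ∘ suc) (slice 1b L) + weightedDif w (map Vec.tail L) ∎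
  where
  open ≡-Reasoning
  F : Subset (suc n) → ℕ
  F Q = w ∣ Q ∣ * countDistinct (map (select Q) L)
  G : Bit → Subset n → ℕ
  G b Q = w (suc ∣ Q ∣) * countDistinct (map (select Q) (slice b L))

  F-inside : ∀ Q → F (inside ∷ Q) ≡ G 0b Q + G 1b Q
  F-inside Q = trans
    (cong (w (suc ∣ Q ∣) *_) (trans (countDistinct-slice (map (select (inside ∷ Q)) L))
      (cong₂ (λ x y → countDistinct x + countDistinct y) (slice-select 0b Q L) (slice-select 1b Q L))))
    (*-distribˡ-+ (w (suc ∣ Q ∣)) _ _)

  F-outside : ∀ Q → F (outside ∷ Q) ≡ w ∣ Q ∣ * countDistinct (map (select Q) (map Vec.tail L))
  F-outside Q = cong (λ z → w ∣ Q ∣ * countDistinct z)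
    (trans (map-cong (λ { (_ ∷ _) → refl }) L) (map-∘ L))

-- Lower bound for distinct rows.

unique-length≤ : {L : List (Row n)} → Unique L → length L ≤ 2 ^ n
unique-length≤ {zero}  {L} L! = unique-⊆⇒length≤ {ys = [ [] ]} L! (λ { {[]} _ → here refl })
unique-length≤ {suc n} {L} L! rewrite slice-length L | +-identityʳ (2 ^ n) =
  +-mono-≤ (unique-length≤ (slice-unique 0b L!)) (unique-length≤ (slice-unique 1b L!))

-- Induction bounds both slices under `w ∘ suc`, and the tails under `w` through the larger slice.
-- By `coverage-pascal` the two bounds from the larger slice merge, and `popSum-subadditive`
-- compares the result with the sum for `L`.
weightedDif-lower : ∀ w {L : List (Row n)} → Unique L → popSum (coverage w n) n (length L) ≤ weightedDif w L
weightedDif-lower {zero} w {[]}     L! = z≤n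
weightedDif-lower {zero} w {[] ∷ L} L! =
  ≤-trans (≤-reflexive (sym (*-identityʳ (w 0)))) (≤-trans (*-monoʳ-≤ (w 0) (s≤s z≤n)) (m≤m+n _ 0))
weightedDif-lower {suc n} w {L} L! = begin
  popSum c (suc n) (length L)
    ≡⟨ cong (popSum c (suc n)) (slice-length L) ⟩
  popSum c (suc n) (len 0b + len 1b)
    ≤⟨ balance (≤-total (len 0b) (len 1b)) ⟩
  weightedDif w′ (slice 0b L) + weightedDif w′ (slice 1b L) + weightedDif w (map Vec.tail L)
    ≡⟨ weightedDif-slice w L ⟨
  weightedDif w L ∎
  where
  open ≤-Reasoning
  c = coverage w (suc n)
  w′ = w ∘ suc
  len : Bit → ℕ
  len b = length (slice b L)

  bound : ∀ b b′ → len b′ ≤ len b → popSum c (suc n) (len b + len b′) ≤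
          weightedDif w′ (slice b L) + weightedDif w′ (slice b′ L) + weightedDif w (map Vec.tail L)
  bound b b′ le = begin
    popSum c (suc n) (len b + len b′)
      ≤⟨ popSum-subadditive (coverage-antitone w (suc n)) (suc n) le ⟩
    popSum c (suc n) (len b) + popSum (c ∘ suc) (suc n) (len b′)
      ≡⟨ cong₂ _+_ (popSum-stable c n (unique-length≤ (slice-unique b L!)))
                   (popSum-stable (c ∘ suc) n (unique-length≤ (slice-unique b′ L!))) ⟩
    -- `c ∘ suc` is `coverage w′ n` by definition.
    popSum c n (len b) + popSum (coverage w′ n) n (len b′)
      ≡⟨ cong (_+ popSum (coverage w′ n) n (len b′)) (popSum-+ n (coverage-pascal w n) (len b)) ⟩
    popSum (coverage w′ n) n (len b) + popSum (coverage w n) n (len b) + popSum (coverage w′ n) n (len b′)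
      ≡⟨ swap (popSum (coverage w′ n) n (len b)) _ _ ⟩
    popSum (coverage w′ n) n (len b) + popSum (coverage w′ n) n (len b′) + popSum (coverage w n) n (len b)
      ≤⟨ +-mono-≤ (+-mono-≤ (weightedDif-lower w′ (slice-unique b L!)) (weightedDif-lower w′ (slice-unique b′ L!)))
                  -- The tails may repeat, so induction is applied to the larger slice, which they
                  -- contain.
                  (≤-trans (weightedDif-lower w (slice-unique b L!)) (weightedDif-mono w (slice⊆tails b L))) ⟩
    weightedDif w′ (slice b L) + weightedDif w′ (slice b′ L) + weightedDif w (map Vec.tail L) ∎
    where
    swap : ∀ x y z → x + y + z ≡ x + z + y
    swap = solve-∀

  balance : len 0b ≤ len 1b ⊎ len 1b ≤ len 0b → popSum c (suc n) (len 0b + len 1b) ≤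
            weightedDif w′ (slice 0b L) + weightedDif w′ (slice 1b L) + weightedDif w (map Vec.tail L)
  balance (inj₂ le) = bound 0b 1b le
  balance (inj₁ le) = subst₂ _≤_ (cong (popSum c (suc n)) (+-comm (len 1b) (len 0b)))
    (cong (_+ weightedDif w (map Vec.tail L)) (+-comm (weightedDif w′ (slice 1b L)) _)) (bound 1b 0b le)

-- Upper bound for rows of small value.

value : Row n → ℕ
value []              = 0
value (_∷_ {n} b r) = 2 ^ n * toℕ b + value r

value-binary : ∀ n (i : Fin (2 ^ n)) → value (binary {n} i) ≡ toℕ i
value-binary zero    zero = refl
value-binary (suc n) i    = begin
  2 ^ n * toℕ (quotient {2} (2 ^ n) i) + value (binary {n} (remainder {2} (2 ^ n) i))
    ≡⟨ cong (2 ^ n * toℕ (quotient {2} (2 ^ n) i) +_) (value-binary n (remainder {2} (2 ^ n) i)) ⟩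
  2 ^ n * toℕ (quotient {2} (2 ^ n) i) + toℕ (remainder {2} (2 ^ n) i)
    ≡⟨ Fin.toℕ-combine (quotient {2} (2 ^ n) i) (remainder {2} (2 ^ n) i) ⟨
  toℕ (uncurry combine (remQuot {2} (2 ^ n) i))
    ≡⟨ cong toℕ (Fin.combine-remQuot {2} (2 ^ n) i) ⟩
  toℕ i ∎
  where open ≡-Reasoning

value<2^n : (r : Row n) → value r < 2 ^ n
value<2^n [] = s≤s z≤n
value<2^n {suc n} (zero ∷ r) rewrite *-zeroʳ (2 ^ n) = ≤-trans (value<2^n r) (m≤m+n _ _)
value<2^n {suc n} (suc zero ∷ r) rewrite *-identityʳ (2 ^ n) | +-identityʳ (2 ^ n) = +-monoʳ-< (2 ^ n) (value<2^n r)

-- Stated for any list of rows of value below `k`, possibly with repetitions, so that it passes to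
-- slices and tails. The cases record whether rows with leading bit 1 can occur.
weightedDif-upper : ∀ w {k} {L : List (Row n)} → (∀ {r} → r ∈ L → value r < k) →
  weightedDif w L ≤ popSum (coverage w n) n k
weightedDif-upper {zero} w {zero} {[]} small = ≤-reflexive (trans (+-identityʳ _) (*-zeroʳ (w 0)))
weightedDif-upper {zero} w {zero} {r ∷ L} small with small (here refl)
... | ()
weightedDif-upper {zero} w {suc k} {L} small = begin
  w 0 * countDistinct (map (select []) L) + 0 ≡⟨ +-identityʳ _ ⟩
  w 0 * countDistinct (map (select []) L)     ≤⟨ *-monoʳ-≤ (w 0) (countDistinct-mono {L = map (select []) L} {L′ = [ [] ]} (λ { {[]} _ → here refl })) ⟩
  w 0 * 1                                     ≡⟨ *-identityʳ (w 0) ⟩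
  w 0                                         ∎
  where open ≤-Reasoning
weightedDif-upper {suc n} w {k} {L} small with ≤-total k (2 ^ n)
... | inj₁ k≤2ⁿ = begin
  weightedDif w L
    ≡⟨ weightedDif-slice w L ⟩
  weightedDif w′ (slice 0b L) + weightedDif w′ (slice 1b L) + weightedDif w (map Vec.tail L)
    ≤⟨ +-mono-≤ (+-mono-≤ (weightedDif-upper w′ small₀) (weightedDif-upper w′ small₁)) (weightedDif-upper w small-tail) ⟩
  popSum c′ n k + popSum c′ n 0 + popSum (coverage w n) n k
    ≡⟨ cong (λ z → popSum c′ n k + z + popSum (coverage w n) n k) (popSum-empty c′ n) ⟩
  popSum c′ n k + 0 + popSum (coverage w n) n k
    ≡⟨ cong (_+ popSum (coverage w n) n k) (+-identityʳ _) ⟩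
  popSum c′ n k + popSum (coverage w n) n k
    ≡⟨ popSum-+ n (coverage-pascal w n) k ⟨
  popSum (coverage w (suc n)) n k
    ≡⟨ popSum-stable (coverage w (suc n)) n k≤2ⁿ ⟨
  popSum (coverage w (suc n)) (suc n) k ∎
  where
  open ≤-Reasoning
  w′ = w ∘ suc
  c′ = coverage w′ n
  small₀ : ∀ {r} → r ∈ slice 0b L → value r < k
  small₀ {r} r∈ = ≤-<-trans (m≤n+m (value r) (2 ^ n * 0)) (small (∈-slice⁻ L r∈))
  -- A leading 1 makes the value at least `2 ^ n`, hence at least `k`; the bound 0 expresses that
  -- this slice is empty.
  small₁ : ∀ {r} → r ∈ slice 1b L → value r < 0
  small₁ {r} r∈ = contradiction (≤-trans k≤2ⁿ (≤-trans (≤-reflexive (sym (*-identityʳ (2 ^ n)))) (m≤m+n _ (value r))))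
    (<⇒≱ (small (∈-slice⁻ L r∈)))
  small-tail : ∀ {r} → r ∈ map Vec.tail L → value r < k
  small-tail r∈ with ∈-map⁻ Vec.tail r∈
  ... | b ∷ r , p , refl = ≤-<-trans (m≤n+m (value r) (2 ^ n * toℕ b)) (small p)
... | inj₂ 2ⁿ≤k = begin
  weightedDif w L
    ≡⟨ weightedDif-slice w L ⟩
  weightedDif w′ (slice 0b L) + weightedDif w′ (slice 1b L) + weightedDif w (map Vec.tail L)
    -- The 0-slice and the tails get the trivial bound `2 ^ n`; the 1-slice gets what remains of
    -- `k`.
    ≤⟨ +-mono-≤ (+-mono-≤ (weightedDif-upper w′ {L = slice 0b L} (λ {r} _ → value<2^n r)) (weightedDif-upper w′ small₁))
                (weightedDif-upper w {L = map Vec.tail L} (λ {r} _ → value<2^n r)) ⟩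
  popSum c′ n (2 ^ n) + popSum c′ n (k ∸ 2 ^ n) + popSum (coverage w n) n (2 ^ n)
    ≡⟨ swap (popSum c′ n (2 ^ n)) _ _ ⟩
  popSum c′ n (2 ^ n) + popSum (coverage w n) n (2 ^ n) + popSum c′ n (k ∸ 2 ^ n)
    ≡⟨ cong (_+ popSum c′ n (k ∸ 2 ^ n)) (popSum-+ n (coverage-pascal w n) (2 ^ n)) ⟨
  popSum (coverage w (suc n)) n (2 ^ n) + popSum c′ n (k ∸ 2 ^ n)
    ≡⟨ popSum-2^n+ (coverage w (suc n)) n (k ∸ 2 ^ n) ⟨
  popSum (coverage w (suc n)) (suc n) (2 ^ n + (k ∸ 2 ^ n))
    ≡⟨ cong (popSum (coverage w (suc n)) (suc n)) (m+[n∸m]≡n 2ⁿ≤k) ⟩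
  popSum (coverage w (suc n)) (suc n) k ∎
  where
  open ≤-Reasoning
  w′ = w ∘ suc
  c′ = coverage w′ n
  swap : ∀ x y z → x + y + z ≡ x + z + y
  swap = solve-∀
  small₁ : ∀ {r} → r ∈ slice 1b L → value r < k ∸ 2 ^ n
  small₁ {r} r∈ = m+n≤o⇒m≤o∸n (suc (value r)) (≤-trans
    (≤-reflexive (cong suc (trans (+-comm (value r) (2 ^ n)) (cong (_+ value r) (sym (*-identityʳ (2 ^ n)))))))
    (small (∈-slice⁻ L r∈)))

-- Return to column sets of size `q`, and the minimum.

indicator : ℕ → ℕ → ℕ
indicator q j = if does (j ≟ q) then 1 else 0

sum-map-filter : ∀ q (size f : A → ℕ) xs →
  sum (map f (filter (λ x → size x ≟ q) xs)) ≡ sum (map (λ x → indicator q (size x) * f x) xs)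
sum-map-filter q size f []       = refl
sum-map-filter q size f (x ∷ xs) with does (size x ≟ q)
... | true  = cong₂ _+_ (sym (+-identityʳ (f x))) (sum-map-filter q size f xs)
... | false = sum-map-filter q size f xs

mOf≡weightedDif : ∀ q (M : Matrix k n) → mOf q M ≡ weightedDif (indicator q) (toList M)
mOf≡weightedDif {n = n} q M = trans
  (sum-map-filter q ∣_∣ (λ Q → dif (M ⟨ Q ⟩)) (subsets n))
  (cong sum (map-cong (λ Q → cong (λ z → indicator q ∣ Q ∣ * countDistinct z) (Vec.toList-map (select Q) M)) (subsets n)))

toList-unique : {M : Matrix k n} → DistinctRows M → Unique (toList M)
toList-unique VecAllPairs.[]       = []
toList-unique (r∉ VecAllPairs.∷ M!) = VecAll.toList⁺ r∉ ∷ toList-unique M!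

H-value< : ∀ n k .(k≤2ⁿ : k ≤ 2 ^ n) {r} → r ∈ toList (H n k k≤2ⁿ) → value r < k
H-value< n k k≤2ⁿ r∈ with VecAny.tabulate⁻ (VecAny.toList⁻ r∈)
... | i , refl = subst (_< k) (sym (trans (value-binary n (inject≤ i k≤2ⁿ)) (Fin.toℕ-inject≤ i k≤2ⁿ))) (Fin.toℕ<n i)

-- The upper bound for `H` and the lower bound for `M` are the same `popSum`, taken at the 0/1
-- weight selecting size `q`.
h≤mOf : ∀ q n k .(k≤2ⁿ : k ≤ 2 ^ n) (M : Matrix k n) → DistinctRows M → h q n k k≤2ⁿ ≤ mOf q M
h≤mOf q n k k≤2ⁿ M M! = begin
  mOf q (H n k k≤2ⁿ)                                  ≡⟨ mOf≡weightedDif q (H n k k≤2ⁿ) ⟩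
  weightedDif w (toList (H n k k≤2ⁿ))                 ≤⟨ weightedDif-upper w (H-value< n k k≤2ⁿ) ⟩
  popSum (coverage w n) n k                           ≡⟨ cong (popSum (coverage w n) n) (Vec.length-toList M) ⟨
  popSum (coverage w n) n (length (toList M))         ≤⟨ weightedDif-lower w (toList-unique M!) ⟩
  weightedDif w (toList M)                            ≡⟨ mOf≡weightedDif q M ⟨
  mOf q M                                             ∎
  where
  open ≤-Reasoning
  w = indicator q

-- `H` is itself a competitor, which gives one inequality; `h≤mOf` at a minimizer gives the other.
-- Only the defining property of a minimum enters, so the search behind `m` is never unfolded.
minimum≡h : ∀ q n k .(k≤2ⁿ : k ≤ 2 ^ n) {v} → IsMinimum (DistinctRows {k} {n}) (mOf q) v → v ≡ h q n k k≤2ⁿ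
minimum≡h q n k k≤2ⁿ ((M , M! , refl) , least) =
  ≤-antisym (least (H n k k≤2ⁿ) (H-distinctRows n k k≤2ⁿ)) (h≤mOf q n k k≤2ⁿ M M!)

theorem2p1 : (q n k : ℕ) .{{_ : NonZero q}} .{{_ : NonZero n}} .{{_ : NonZero k}} →
    q ≤ n → (k≤2ⁿ : k ≤ 2 ^ n) → m q n k k≤2ⁿ ≡ h q n k k≤2ⁿ
theorem2p1 q n k q≤n k≤2ⁿ = minimum≡h q n k k≤2ⁿ (proj₂ (minimum-exists q n k k≤2ⁿ))
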